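{- Let $n\geq 1$, let $\varphi:L_n([0,1])\to L_n([0,1])$ be an $n$-dimensional automorphism, let $\mathcal{N}:L_n([0,1])\to L_n([0,1])$ be a function, and define $\mathcal{N}^{\varphi}(\mathbf{x})=\varphi^{ -1}(\mathcal{N}(\varphi(\mathbf{x})))$ for all $\mathbf{x}\in L_n([0,1])$. Then: (a) $\mathcal{N}$ is an $n$-dimensional fuzzy negation if and only if $\mathcal{N}^{\varphi}$ is an $n$-dimensional fuzzy negation; (b) $\mathcal{N}$ is an $n$-dimensional strict fuzzy negation if and only if $\mathcal{N}^{\varphi}$ is an $n$-dimensional strict fuzzy negation; (c) $\mathcal{N}$ is an $n$-dimensional strong fuzzy negation if and only if $\mathcal{N}^{\varphi}$ is an $n$-dimensional strong fuzzy negation.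
   Context: $L_n([0,1])=\{(x_1,\ldots,x_n)\in[0,1]^n : x_1\leq\cdots\leq x_n\}$ with the componentwise order; $\mathbf{x}<\mathbf{y}$ means $\mathbf{x}\leq\mathbf{y}$ and $\mathbf{x}\neq\mathbf{y}$. For $x\in[0,1]$, $/x/=(x,\ldots,x)$. An $n$-dimensional automorphism is a bijection $\varphi:L_n([0,1])\to L_n([0,1])$ such that $\mathbf{x}\leq\mathbf{y}$ iff $\varphi(\mathbf{x})\leq\varphi(\mathbf{y})$. An $n$-dimensional fuzzy negation is a function $\mathcal{N}:L_n([0,1])\to L_n([0,1])$ with $\mathcal{N}(/0/)=/1/$, $\mathcal{N}(/1/)=/0/$ and $\mathcal{N}(\mathbf{x})\geq\mathcal{N}(\mathbf{y})$ whenever $\mathbf{x}\leq\mathbf{y}$. It is strong if $\mathcal{N}(\mathcal{N}(\mathbf{x}))=\mathbf{x}$ for all $\mathbf{x}$. It is strict if it is continuous and strictly decreasing, i.e. $\mathcal{N}(\mathbf{x})<\mathcal{N}(\mathbf{y})$ whenever $\mathbf{y}<\mathbf{x}$. Continuity of $F:L_n([0,1])\to L_n([0,1])$ means that the map $\sigma\circ F\circ\rho:[0,1]^n\to[0,1]^n$ is continuous in the usual sense, where $\rho:[0,1]^n\to L_n([0,1])$ sorts a tuple into increasing order and $\sigma:L_n([0,1])\to[0,1]^n$ is the inclusion. -}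

module Defs where

open import Axiom.ExcludedMiddle using (ExcludedMiddle)
open import Data.Fin.Base as Fin using (Fin; zero; suc)
import Data.List.Base as List
open import Data.List.Relation.Binary.Permutation.Setoid as Permutation using ()
open import Data.Nat.Base as ℕ using (ℕ; zero; suc; z≤n; s≤s)
import Data.Nat.Properties as ℕₚ
open import Data.Product.Base using (∃; _×_; _,_; proj₁; proj₂)
open import Data.Rational.Base as ℚ using (ℚ; 0ℚ; 1ℚ; ½)
import Data.Rational.Properties as ℚₚ
open import Data.Rational.Solver using (module +-*-Solver)
open import Data.Sum.Base using (_⊎_; inj₁; inj₂)
open import Data.Vec.Functional using (Vector; []; _∷_; head; tail; toList)
open import Function.Base using (_∘_; const)
open import Function.Bundles using (Bijection; Func; Inverse; _⇔_)
open import Function.Properties.Bijection using (Bijection⇒Inverse)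
open import Level using (0ℓ)
open import Relation.Binary.Bundles using (Setoid)
open import Relation.Binary.Core using (_Preserves_⟶_)
open import Relation.Binary.PropositionalEquality using (_≡_; refl; sym; cong; subst)
open import Relation.Nullary using (¬_; yes; no; contradiction)

private
  Close : ℚ → ℚ → ℚ → Set
  Close ε p q = ℚ.∣ p ℚ.- q ∣ ℚ.< ε

  half : ∀ {ε} → 0ℚ ℚ.< ε → 0ℚ ℚ.< ½ ℚ.* ε
  half {ε} 0<ε = subst (ℚ._< ½ ℚ.* ε) (ℚₚ.*-zeroʳ ½) (ℚₚ.*-monoʳ-<-pos ½ 0<ε)

  half+half : ∀ ε → ½ ℚ.* ε ℚ.+ ½ ℚ.* ε ≡ ε
  half+half = solve 1 (λ ε → con ½ :* ε :+ con ½ :* ε := ε) refl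
    where open +-*-Solver

  q+[p-q] : ∀ p q → q ℚ.+ (p ℚ.- q) ≡ p
  q+[p-q] = solve 2 (λ p q → q :+ (p :- q) := p) refl
    where open +-*-Solver

  [q+ε]-q : ∀ q ε → (q ℚ.+ ε) ℚ.- q ≡ ε
  [q+ε]-q = solve 2 (λ q ε → (q :+ ε) :- q := ε) refl
    where open +-*-Solver

  p≤∣p∣ : ∀ p → p ℚ.≤ ℚ.∣ p ∣
  p≤∣p∣ p with ℚₚ.≤-total 0ℚ p
  ... | inj₁ 0≤p = ℚₚ.≤-reflexive (sym (ℚₚ.0≤p⇒∣p∣≡p 0≤p))
  ... | inj₂ p≤0 = ℚₚ.≤-trans p≤0 (ℚₚ.0≤∣p∣ p)

  p<p+ε : ∀ p {ε} → 0ℚ ℚ.< ε → p ℚ.< p ℚ.+ ε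
  p<p+ε p {ε} 0<ε = subst (ℚ._< p ℚ.+ ε) (ℚₚ.+-identityʳ p) (ℚₚ.+-monoʳ-< p 0<ε)

  close-refl : ∀ p {ε} → 0ℚ ℚ.< ε → Close ε p p
  close-refl p {ε} = subst (ℚ._< ε) (sym (cong ℚ.∣_∣ (ℚₚ.+-inverseʳ p)))

  close-sym : ∀ {ε} p q → Close ε p q → Close ε q p
  close-sym {ε} p q = subst (ℚ._< ε) ∣p-q∣≡∣q-p∣
    where
    open +-*-Solver
    ∣p-q∣≡∣q-p∣ : ℚ.∣ p ℚ.- q ∣ ≡ ℚ.∣ q ℚ.- p ∣
    ∣p-q∣≡∣q-p∣ rewrite sym (ℚₚ.∣-p∣≡∣p∣ (p ℚ.- q)) =
      cong ℚ.∣_∣ (solve 2 (λ p q → :- (p :- q) := q :- p) refl p q)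

  close⇒< : ∀ {ε} p q → Close ε p q → p ℚ.< q ℚ.+ ε
  close⇒< p q c = subst (ℚ._< _) (q+[p-q] p q)
    (ℚₚ.+-monoʳ-< q (ℚₚ.≤-<-trans (p≤∣p∣ (p ℚ.- q)) c))

  <⇒-< : ∀ {ε} p q → p ℚ.< q ℚ.+ ε → p ℚ.- q ℚ.< ε
  <⇒-< {ε} p q p<q+ε = subst (_ ℚ.<_) ([q+ε]-q q ε) (ℚₚ.+-monoˡ-< (ℚ.- q) p<q+ε)

  <⇒close : ∀ {ε} p q → p ℚ.< q ℚ.+ ε → q ℚ.< p ℚ.+ ε → Close ε p q
  <⇒close {ε} p q p<q+ε q<p+ε with ℚₚ.∣p∣≡p∨∣p∣≡-p (p ℚ.- q)
  ... | inj₁ eq = subst (ℚ._< ε) (sym eq) (<⇒-< p q p<q+ε)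
  ... | inj₂ eq = subst (ℚ._< ε) (sym (ℚ-trans eq)) (<⇒-< q p q<p+ε)
    where
    open +-*-Solver
    ℚ-trans : ∀ {r} → r ≡ ℚ.- (p ℚ.- q) → r ≡ q ℚ.- p
    ℚ-trans refl = solve 2 (λ p q → :- (p :- q) := q :- p) refl p q

  <-trans-half : ∀ {ε} p q r → p ℚ.< q ℚ.+ ½ ℚ.* ε → q ℚ.< r ℚ.+ ½ ℚ.* ε → p ℚ.< r ℚ.+ ε
  <-trans-half {ε} p q r p<q q<r = subst (p ℚ.<_) r+½ε+½ε≡r+ε
    (ℚₚ.<-trans p<q (ℚₚ.+-monoˡ-< (½ ℚ.* ε) q<r))
    where
    open +-*-Solver
    r+½ε+½ε≡r+ε : (r ℚ.+ ½ ℚ.* ε) ℚ.+ ½ ℚ.* ε ≡ r ℚ.+ ε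
    r+½ε+½ε≡r+ε = solve 2 (λ r ε → (r :+ con ½ :* ε) :+ con ½ :* ε := r :+ ε) refl r ε

  close-trans : ∀ {ε} p q r → Close (½ ℚ.* ε) p q → Close (½ ℚ.* ε) q r → Close ε p r
  close-trans p q r p~q q~r = <⇒close p r
    (<-trans-half p q r (close⇒< p q p~q) (close⇒< q r q~r))
    (<-trans-half r q p (close⇒< r q (close-sym q r q~r)) (close⇒< q p (close-sym p q p~q)))

  close-- : ∀ {ε} p q r s → Close (½ ℚ.* ε) p q → Close (½ ℚ.* ε) r s → Close ε (p ℚ.- r) (q ℚ.- s)
  close-- {ε} p q r s p~q r~s = begin-strict
    ℚ.∣ (p ℚ.- r) ℚ.- (q ℚ.- s) ∣           ≡⟨ cong ℚ.∣_∣ rearrange ⟩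
    ℚ.∣ (p ℚ.- q) ℚ.- (r ℚ.- s) ∣           ≤⟨ ℚₚ.∣p-q∣≤∣p∣+∣q∣ (p ℚ.- q) (r ℚ.- s) ⟩
    ℚ.∣ p ℚ.- q ∣ ℚ.+ ℚ.∣ r ℚ.- s ∣         <⟨ ℚₚ.+-mono-< p~q r~s ⟩
    ½ ℚ.* ε ℚ.+ ½ ℚ.* ε                     ≡⟨ half+half ε ⟩
    ε                                       ∎
    where
    open ℚₚ.≤-Reasoning
    open +-*-Solver
    rearrange : (p ℚ.- r) ℚ.- (q ℚ.- s) ≡ (p ℚ.- q) ℚ.- (r ℚ.- s)
    rearrange = solve 4 (λ p q r s → (p :- r) :- (q :- s) := (p :- q) :- (r :- s)) refl p q r s

  close-∣∣ : ∀ {ε} p q → Close ε p q → Close ε ℚ.∣ p ∣ ℚ.∣ q ∣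
  close-∣∣ {ε} p q p~q = <⇒close ℚ.∣ p ∣ ℚ.∣ q ∣ (one p q p~q) (one q p (close-sym p q p~q))
    where
    open ℚₚ.≤-Reasoning
    one : ∀ p q → Close ε p q → ℚ.∣ p ∣ ℚ.< ℚ.∣ q ∣ ℚ.+ ε
    one p q p~q = begin-strict
      ℚ.∣ p ∣                        ≡⟨ cong ℚ.∣_∣ (q+[p-q] p q) ⟨
      ℚ.∣ q ℚ.+ (p ℚ.- q) ∣          ≤⟨ ℚₚ.∣p+q∣≤∣p∣+∣q∣ q (p ℚ.- q) ⟩
      ℚ.∣ q ∣ ℚ.+ ℚ.∣ p ℚ.- q ∣      <⟨ ℚₚ.+-monoʳ-< ℚ.∣ q ∣ p~q ⟩
      ℚ.∣ q ∣ ℚ.+ ε                  ∎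

  ⊓<⊓ : ∀ {ε} p q r s → p ℚ.< q ℚ.+ ε → r ℚ.< s ℚ.+ ε → p ℚ.⊓ r ℚ.< (q ℚ.⊓ s) ℚ.+ ε
  ⊓<⊓ {ε} p q r s p<q r<s with ℚₚ.⊓-sel q s
  ... | inj₁ eq = subst (λ t → _ ℚ.< t ℚ.+ ε) (sym eq) (ℚₚ.≤-<-trans (ℚₚ.p⊓q≤p p r) p<q)
  ... | inj₂ eq = subst (λ t → _ ℚ.< t ℚ.+ ε) (sym eq) (ℚₚ.≤-<-trans (ℚₚ.p⊓q≤q p r) r<s)

  ⊔<⊔ : ∀ {ε} p q r s → p ℚ.< q ℚ.+ ε → r ℚ.< s ℚ.+ ε → p ℚ.⊔ r ℚ.< (q ℚ.⊔ s) ℚ.+ ε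
  ⊔<⊔ {ε} p q r s p<q r<s with ℚₚ.⊔-sel p r
  ... | inj₁ eq = subst (ℚ._< _) (sym eq) (ℚₚ.<-≤-trans p<q (ℚₚ.+-monoˡ-≤ ε (ℚₚ.p≤p⊔q q s)))
  ... | inj₂ eq = subst (ℚ._< _) (sym eq) (ℚₚ.<-≤-trans r<s (ℚₚ.+-monoˡ-≤ ε (ℚₚ.p≤q⊔p q s)))

  close-⊓ : ∀ {ε} p q r s → Close ε p q → Close ε r s → Close ε (p ℚ.⊓ r) (q ℚ.⊓ s)
  close-⊓ p q r s p~q r~s = <⇒close (p ℚ.⊓ r) (q ℚ.⊓ s)
    (⊓<⊓ p q r s (close⇒< p q p~q) (close⇒< r s r~s))
    (⊓<⊓ q p s r (close⇒< q p (close-sym p q p~q)) (close⇒< s r (close-sym r s r~s)))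

  close-⊔ : ∀ {ε} p q r s → Close ε p q → Close ε r s → Close ε (p ℚ.⊔ r) (q ℚ.⊔ s)
  close-⊔ p q r s p~q r~s = <⇒close (p ℚ.⊔ r) (q ℚ.⊔ s)
    (⊔<⊔ p q r s (close⇒< p q p~q) (close⇒< r s r~s))
    (⊔<⊔ q p s r (close⇒< q p (close-sym p q p~q)) (close⇒< s r (close-sym r s r~s)))

-- The real numbers: Cauchy sequences of rationals, with equality meaning
-- that the difference of the sequences tends to zero.
IsCauchy : (ℕ → ℚ) → Set
IsCauchy a = ∀ {ε} → 0ℚ ℚ.< ε →
  ∃ λ N → ∀ {m n} → N ℕ.≤ m → N ℕ.≤ n → ℚ.∣ a m ℚ.- a n ∣ ℚ.< ε

record ℝ : Set where
  constructor mkℝ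
  field
    seq    : ℕ → ℚ
    cauchy : IsCauchy seq
open ℝ public

Eventually : (ℕ → Set) → Set
Eventually P = ∃ λ N → ∀ {n} → N ℕ.≤ n → P n

infix 4 _≈_ _≤_ _<_
infixl 6 _-_ _⊔_
infixl 7 _⊓_

record _≈_ (x y : ℝ) : Set where
  constructor mk≈
  field
    close : ∀ {ε} → 0ℚ ℚ.< ε → Eventually λ n → ℚ.∣ seq x n ℚ.- seq y n ∣ ℚ.< ε
open _≈_ public

record _≤_ (x y : ℝ) : Set where
  constructor mk≤
  field
    below : ∀ {ε} → 0ℚ ℚ.< ε → Eventually λ n → seq x n ℚ.< seq y n ℚ.+ ε
open _≤_ public

_<_ : ℝ → ℝ → Set
x < y = ∃ λ ε → 0ℚ ℚ.< ε × Eventually λ n → seq x n ℚ.+ ε ℚ.< seq y n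

fromℚ : ℚ → ℝ
fromℚ q = mkℝ (const q) λ 0<ε → 0 , λ _ _ → close-refl q 0<ε

0ℝ 1ℝ : ℝ
0ℝ = fromℚ 0ℚ
1ℝ = fromℚ 1ℚ

private
  abstract
    map₁-cauchy : ∀ (f : ℚ → ℚ) → (∀ {ε} p q → Close ε p q → Close ε (f p) (f q)) →
                  ∀ x → IsCauchy (f ∘ seq x)
    map₁-cauchy f f-close x 0<ε =
      let N , h = cauchy x 0<ε in
      N , λ {m} {n} N≤m N≤n → f-close (seq x m) (seq x n) (h N≤m N≤n)

    map₂-cauchy : ∀ (f : ℚ → ℚ → ℚ) →
      (∀ {ε} p q r s → Close (½ ℚ.* ε) p q → Close (½ ℚ.* ε) r s → Close ε (f p r) (f q s)) →
      ∀ x y → IsCauchy (λ n → f (seq x n) (seq y n))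
    map₂-cauchy f f-close x y 0<ε =
      let M , h = cauchy x (half 0<ε)
          N , k = cauchy y (half 0<ε)
      in M ℕ.⊔ N , λ {m} {n} l≤m l≤n → f-close (seq x m) (seq x n) (seq y m) (seq y n)
        (h (ℕₚ.m⊔n≤o⇒m≤o M N l≤m) (ℕₚ.m⊔n≤o⇒m≤o M N l≤n))
        (k (ℕₚ.m⊔n≤o⇒n≤o M N l≤m) (ℕₚ.m⊔n≤o⇒n≤o M N l≤n))

  close-mono : ∀ {ε} p q → Close (½ ℚ.* ε) p q → Close ε p q
  close-mono {ε} p q p~q = close-trans p q q p~q
    (close-refl q (ℚₚ.≤-<-trans (ℚₚ.0≤∣p∣ (p ℚ.- q)) p~q))

∣_∣ : ℝ → ℝ
∣ x ∣ = mkℝ (λ n → ℚ.∣ seq x n ∣) (map₁-cauchy ℚ.∣_∣ close-∣∣ x)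

_-_ _⊓_ _⊔_ : ℝ → ℝ → ℝ
x - y = mkℝ (λ n → seq x n ℚ.- seq y n) (map₂-cauchy ℚ._-_ close-- x y)
x ⊓ y = mkℝ (λ n → seq x n ℚ.⊓ seq y n) (map₂-cauchy ℚ._⊓_
  (λ p q r s p~q r~s → close-⊓ p q r s (close-mono p q p~q) (close-mono r s r~s)) x y)
x ⊔ y = mkℝ (λ n → seq x n ℚ.⊔ seq y n) (map₂-cauchy ℚ._⊔_
  (λ p q r s p~q r~s → close-⊔ p q r s (close-mono p q p~q) (close-mono r s r~s)) x y)

private
  both : ∀ {P Q : ℕ → Set} → Eventually P → Eventually Q → Eventually λ n → P n × Q n
  both (M , h) (N , k) = M ℕ.⊔ N , λ l≤n →
    h (ℕₚ.m⊔n≤o⇒m≤o M N l≤n) , k (ℕₚ.m⊔n≤o⇒n≤o M N l≤n)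

  always : ∀ {x y} → (∀ n → seq x n ℚ.≤ seq y n) → x ≤ y
  always {_} {y} h = mk≤ λ 0<ε → 0 , λ {n} _ → ℚₚ.≤-<-trans (h n) (p<p+ε (seq y n) 0<ε)

≈-refl : ∀ {x} → x ≈ x
≈-refl {x} = mk≈ λ 0<ε → 0 , λ {n} _ → close-refl (seq x n) 0<ε

≈-sym : ∀ {x y} → x ≈ y → y ≈ x
≈-sym {x} {y} x≈y = mk≈ λ 0<ε →
  let N , h = close x≈y 0<ε in N , λ {n} N≤n → close-sym (seq x n) (seq y n) (h N≤n)

≈-trans : ∀ {x y z} → x ≈ y → y ≈ z → x ≈ z
≈-trans {x} {y} {z} x≈y y≈z = mk≈ λ 0<ε →
  let N , h = both (close x≈y (half 0<ε)) (close y≈z (half 0<ε)) in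
  N , λ {n} N≤n → close-trans (seq x n) (seq y n) (seq z n) (proj₁ (h N≤n)) (proj₂ (h N≤n))

≤-refl : ∀ {x} → x ≤ x
≤-refl = always λ _ → ℚₚ.≤-refl

≤-trans : ∀ {x y z} → x ≤ y → y ≤ z → x ≤ z
≤-trans {x} {y} {z} x≤y y≤z = mk≤ λ 0<ε →
  let N , h = both (below x≤y (half 0<ε)) (below y≤z (half 0<ε)) in
  N , λ {n} N≤n → <-trans-half (seq x n) (seq y n) (seq z n) (proj₁ (h N≤n)) (proj₂ (h N≤n))

≤-antisym : ∀ {x y} → x ≤ y → y ≤ x → x ≈ y
≤-antisym {x} {y} x≤y y≤x = mk≈ λ 0<ε →
  let N , h = both (below x≤y 0<ε) (below y≤x 0<ε) in
  N , λ {n} N≤n → <⇒close (seq x n) (seq y n) (proj₁ (h N≤n)) (proj₂ (h N≤n))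

x⊓y≤x : ∀ x y → x ⊓ y ≤ x
x⊓y≤x x y = always λ n → ℚₚ.p⊓q≤p (seq x n) (seq y n)

x⊓y≤y : ∀ x y → x ⊓ y ≤ y
x⊓y≤y x y = always λ n → ℚₚ.p⊓q≤q (seq x n) (seq y n)

x≤x⊔y : ∀ x y → x ≤ x ⊔ y
x≤x⊔y x y = always λ n → ℚₚ.p≤p⊔q (seq x n) (seq y n)

y≤x⊔y : ∀ x y → y ≤ x ⊔ y
y≤x⊔y x y = always λ n → ℚₚ.p≤q⊔p (seq x n) (seq y n)

⊓-glb : ∀ {x y z} → z ≤ x → z ≤ y → z ≤ x ⊓ y
⊓-glb {x} {y} {z} z≤x z≤y = mk≤ λ 0<ε →
  let N , h = both (below z≤x 0<ε) (below z≤y 0<ε) in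
  N , λ {n} N≤n → subst (ℚ._< _) (ℚₚ.⊓-idem (seq z n))
    (⊓<⊓ (seq z n) (seq x n) (seq z n) (seq y n) (proj₁ (h N≤n)) (proj₂ (h N≤n)))

⊔-lub : ∀ {x y z} → x ≤ z → y ≤ z → x ⊔ y ≤ z
⊔-lub {x} {y} {z} x≤z y≤z = mk≤ λ {ε} 0<ε →
  let N , h = both (below x≤z 0<ε) (below y≤z 0<ε) in
  N , λ {n} N≤n → subst (λ q → _ ℚ.< q ℚ.+ ε) (ℚₚ.⊔-idem (seq z n))
    (⊔<⊔ (seq x n) (seq z n) (seq y n) (seq z n) (proj₁ (h N≤n)) (proj₂ (h N≤n)))

record I : Set where
  constructor mkI
  field
    value : ℝ
    0≤    : 0ℝ ≤ value
    ≤1    : value ≤ 1ℝ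
open I public

infix 4 _≈ᴵ_ _≤ᴵ_
infixl 6 _⊔ᴵ_
infixl 7 _⊓ᴵ_

_≈ᴵ_ _≤ᴵ_ : I → I → Set
x ≈ᴵ y = value x ≈ value y
x ≤ᴵ y = value x ≤ value y

I-setoid : Setoid 0ℓ 0ℓ
I-setoid = record
  { Carrier = I
  ; _≈_ = _≈ᴵ_
  ; isEquivalence = record
    { refl  = ≈-refl
    ; sym   = ≈-sym
    ; trans = ≈-trans
    }
  }

0ᴵ 1ᴵ : I
0ᴵ = mkI 0ℝ ≤-refl (always λ _ → ℚₚ.nonNegative⁻¹ 1ℚ)
1ᴵ = mkI 1ℝ (always λ _ → ℚₚ.nonNegative⁻¹ 1ℚ) ≤-refl

_⊓ᴵ_ _⊔ᴵ_ : I → I → I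
mkI x 0≤x x≤1 ⊓ᴵ mkI y 0≤y _ = mkI (x ⊓ y)
  (⊓-glb 0≤x 0≤y) (≤-trans (x⊓y≤x x y) x≤1)
mkI x 0≤x x≤1 ⊔ᴵ mkI y _ y≤1 = mkI (x ⊔ y)
  (≤-trans 0≤x (x≤x⊔y x y)) (⊔-lub x≤1 y≤1)

record L (n : ℕ) : Set where
  constructor mkL
  field
    coords     : Vector I n
    increasing : coords Preserves Fin._≤_ ⟶ _≤ᴵ_
open L public

infix 4 _≈ᴸ_ _≤ᴸ_ _<ᴸ_

_≈ᴸ_ _≤ᴸ_ _<ᴸ_ : ∀ {n} → L n → L n → Set
x ≈ᴸ y = ∀ i → coords x i ≈ᴵ coords y i
x ≤ᴸ y = ∀ i → coords x i ≤ᴵ coords y i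
x <ᴸ y = x ≤ᴸ y × ¬ (x ≈ᴸ y)

L-setoid : ℕ → Setoid 0ℓ 0ℓ
L-setoid n = record
  { Carrier = L n
  ; _≈_ = _≈ᴸ_
  ; isEquivalence = record
    { refl  = λ i → ≈-refl
    ; sym   = λ p i → ≈-sym (p i)
    ; trans = λ p q i → ≈-trans (p i) (q i)
    }
  }

/_/ : ∀ {n} → I → L n
/ x / = mkL (const x) λ _ → ≤-refl

-- Insertion sort whose compare-and-exchange step replaces a pair (x , y) by
-- (min x y , max x y), so that no decision of the order is needed.  Under
-- excluded middle the result is a permutation of the input: see sort-↭.
insert : ∀ {n} → I → Vector I n → Vector I (suc n)
insert {zero}  x ys = x ∷ []
insert {suc n} x ys = (x ⊓ᴵ head ys) ∷ insert (x ⊔ᴵ head ys) (tail ys)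

sort : ∀ {n} → Vector I n → Vector I n
sort {zero}  xs = []
sort {suc n} xs = insert (head xs) (sort (tail xs))

private
  insert-≥ : ∀ {n} z x (ys : Vector I n) → z ≤ᴵ x → (∀ i → z ≤ᴵ ys i) → ∀ i → z ≤ᴵ insert x ys i
  insert-≥ {zero}  z x ys z≤x z≤ys zero    = z≤x
  insert-≥ {suc n} z x ys z≤x z≤ys zero    =
    ⊓-glb z≤x (z≤ys zero)
  insert-≥ {suc n} z x ys z≤x z≤ys (suc i) =
    insert-≥ z (x ⊔ᴵ head ys) (tail ys)
      (≤-trans z≤x (x≤x⊔y (value x) (value (head ys))))
      (z≤ys ∘ suc) i

  insert-increasing : ∀ {n} x (ys : Vector I n) →
    ys Preserves Fin._≤_ ⟶ _≤ᴵ_ → insert x ys Preserves Fin._≤_ ⟶ _≤ᴵ_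
  insert-increasing {zero}  x ys ys↑ {zero}  {zero}  _ = ≤-refl
  insert-increasing {suc n} x ys ys↑ {zero}  {zero}  _ = ≤-refl
  insert-increasing {suc n} x ys ys↑ {zero}  {suc j} _ =
    insert-≥ (x ⊓ᴵ head ys) (x ⊔ᴵ head ys) (tail ys)
      (≤-trans (x⊓y≤x a b) (x≤x⊔y a b))
      (λ i → ≤-trans (x⊓y≤y a b) (ys↑ z≤n)) j
    where
    a = value x
    b = value (head ys)
  insert-increasing {suc n} x ys ys↑ {suc i} {suc j} (s≤s i≤j) =
    insert-increasing (x ⊔ᴵ head ys) (tail ys) (ys↑ ∘ s≤s) i≤j

sort-increasing : ∀ {n} (xs : Vector I n) → sort xs Preserves Fin._≤_ ⟶ _≤ᴵ_
sort-increasing {suc n} xs = insert-increasing (head xs) (sort (tail xs)) (sort-increasing (tail xs))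

ρ : ∀ {n} → Vector I n → L n
ρ xs = mkL (sort xs) (sort-increasing xs)

σ : ∀ {n} → L n → Vector I n
σ = coords

private
  tail-close : ∀ x y {η} → 0ℚ ℚ.< η → ∃ λ N → ∀ {m n} → N ℕ.≤ m → N ℕ.≤ n →
    Close η (seq x m) (seq x n) × Close η (seq y m) (seq y n)
  tail-close x y 0<η with cauchy x 0<η | cauchy y 0<η
  ... | M , h | N , k = M ℕ.⊔ N , λ l≤m l≤n →
    h (ℕₚ.m⊔n≤o⇒m≤o M N l≤m) (ℕₚ.m⊔n≤o⇒m≤o M N l≤n) ,
    k (ℕₚ.m⊔n≤o⇒n≤o M N l≤m) (ℕₚ.m⊔n≤o⇒n≤o M N l≤n)

  gap : ∀ {ε} a b c d → Close (½ ℚ.* ε) a b → b ℚ.+ ε ℚ.≤ c → Close (½ ℚ.* ε) c d → a ℚ.< d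
  gap {ε} a b c d a~b b+ε≤c c~d = begin-strict
    a                      <⟨ close⇒< a b a~b ⟩
    b ℚ.+ η                ≡⟨ solve 2 (λ b ε → b :+ con ½ :* ε := (b :+ ε) :- con ½ :* ε) refl b ε ⟩
    (b ℚ.+ ε) ℚ.- η        ≤⟨ ℚₚ.+-monoˡ-≤ (ℚ.- η) b+ε≤c ⟩
    c ℚ.- η                <⟨ ℚₚ.+-monoˡ-< (ℚ.- η) (close⇒< c d c~d) ⟩
    (d ℚ.+ η) ℚ.- η        ≡⟨ solve 2 (λ d η → (d :+ η) :- η := d) refl d η ⟩
    d                      ∎
    where
    open ℚₚ.≤-Reasoning
    open +-*-Solver
    η = ½ ℚ.* ε

≤-total : ExcludedMiddle 0ℓ → ∀ x y → x ≤ y ⊎ y ≤ x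
≤-total em x y with em {x ≤ y}
... | yes x≤y = inj₁ x≤y
... | no  x≰y = inj₂ y≤x
  where
  y≤x : y ≤ x
  below y≤x {ε} 0<ε with tail-close x y (half 0<ε)
  ... | N , h = N , step
    where
    step : ∀ {n} → N ℕ.≤ n → seq y n ℚ.< seq x n ℚ.+ ε
    step {n} N≤n with seq y n ℚₚ.<? seq x n ℚ.+ ε
    ... | yes y<x+ε = y<x+ε
    ... | no  y≮x+ε = contradiction x≤y x≰y
      where
      x≤y : x ≤ y
      below x≤y 0<δ = N , λ {m} N≤m → ℚₚ.<-trans
        (gap (seq x m) (seq x n) (seq y n) (seq y m)
          (proj₁ (h N≤m N≤n)) (ℚₚ.≮⇒≥ y≮x+ε) (proj₂ (h N≤n N≤m)))
        (p<p+ε (seq y m) 0<δ)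

module _ (em : ExcludedMiddle 0ℓ) where
  open Permutation I-setoid using (_↭_; ↭-refl; ↭-trans; prep; swap)

  private
    ordered : ∀ u v x y {as bs} → u ≈ᴵ x → v ≈ᴵ y →
      as ↭ v List.∷ bs → u List.∷ as ↭ x List.∷ y List.∷ bs
    ordered u v x y u≈x v≈y as↭ =
      ↭-trans (prep {x = u} {x} u≈x as↭) (prep {x = x} {x} ≈-refl (prep {x = v} {y} v≈y ↭-refl))

    exchanged : ∀ u v x y {as bs} → u ≈ᴵ y → v ≈ᴵ x →
      as ↭ v List.∷ bs → u List.∷ as ↭ x List.∷ y List.∷ bs
    exchanged u v x y u≈y v≈x as↭ =
      ↭-trans (prep {x = u} {y} u≈y as↭) (swap {x = y} {v} {y} {x} ≈-refl v≈x ↭-refl)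

    compare-↭ : ∀ x y {as bs} → value x ≤ value y ⊎ value y ≤ value x →
      as ↭ (x ⊔ᴵ y) List.∷ bs → (x ⊓ᴵ y) List.∷ as ↭ x List.∷ y List.∷ bs
    compare-↭ x y (inj₁ x≤y) = ordered (x ⊓ᴵ y) (x ⊔ᴵ y) x y
      (≤-antisym (x⊓y≤x (value x) (value y)) (⊓-glb ≤-refl x≤y))
      (≤-antisym (⊔-lub x≤y ≤-refl) (y≤x⊔y (value x) (value y)))
    compare-↭ x y (inj₂ y≤x) = exchanged (x ⊓ᴵ y) (x ⊔ᴵ y) x y
      (≤-antisym (x⊓y≤y (value x) (value y)) (⊓-glb y≤x ≤-refl))
      (≤-antisym (⊔-lub ≤-refl y≤x) (x≤x⊔y (value x) (value y)))

    insert-↭ : ∀ {n} x (ys : Vector I n) → toList (insert x ys) ↭ x List.∷ toList ys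
    insert-↭ {zero}  x ys = ↭-refl
    insert-↭ {suc n} x ys = compare-↭ x (head ys) (≤-total em (value x) (value (head ys)))
      (insert-↭ (x ⊔ᴵ head ys) (tail ys))

  sort-↭ : ∀ {n} (xs : Vector I n) → toList (sort xs) ↭ toList xs
  sort-↭ {zero}  xs = ↭-refl
  sort-↭ {suc n} xs = ↭-trans (insert-↭ (head xs) (sort (tail xs)))
    (prep (≈-refl {value (head xs)}) (sort-↭ (tail xs)))

-- The maximum distance on [0,1]ⁿ is used; it induces the usual topology.
IsContinuousCube : ∀ {n} → (Vector I n → Vector I n) → Set
IsContinuousCube {n} G =
  ∀ (x : Vector I n) (ε : ℝ) → 0ℝ < ε →
  ∃ λ (δ : ℝ) → 0ℝ < δ ×
    ∀ (y : Vector I n) → (∀ i → ∣ value (x i) - value (y i) ∣ < δ) →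
    ∀ i → ∣ value (G x i) - value (G y i) ∣ < ε

IsContinuous : ∀ {n} → (L n → L n) → Set
IsContinuous F = IsContinuousCube (σ ∘ F ∘ ρ)

record Automorphism (n : ℕ) : Set where
  field
    bijection : Bijection (L-setoid n) (L-setoid n)

  open Bijection bijection public using (to)

  field
    ≤-⇔ : ∀ x y → x ≤ᴸ y ⇔ to x ≤ᴸ to y

  open Inverse (Bijection⇒Inverse bijection) public
    using (from; to-cong; from-cong)

-- Functions Lₙ([0,1]) → Lₙ([0,1]), that is, maps compatible with equality of
-- real vectors.
Endo : ℕ → Set
Endo n = Func (L-setoid n) (L-setoid n)

module _ {n : ℕ} (𝒩 : Endo n) where
  open Func 𝒩 renaming (to to N)

  record IsFuzzyNegation : Set where
    field
      N-/0/ : N / 0ᴵ / ≈ᴸ / 1ᴵ /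
      N-/1/ : N / 1ᴵ / ≈ᴸ / 0ᴵ /
      antitone : ∀ x y → x ≤ᴸ y → N y ≤ᴸ N x

  record IsStrictFuzzyNegation : Set where
    field
      isFuzzyNegation    : IsFuzzyNegation
      continuous         : IsContinuous N
      strictlyDecreasing : ∀ x y → y <ᴸ x → N x <ᴸ N y

  record IsStrongFuzzyNegation : Set where
    field
      isFuzzyNegation : IsFuzzyNegation
      involutive      : ∀ x → N (N x) ≈ᴸ x

infixl 8 _^_

_^_ : ∀ {n} → Endo n → Automorphism n → Endo n
𝒩 ^ φ = record
  { to   = λ x → φ.from (𝒩.to (φ.to x))
  ; cong = λ x≈y → φ.from-cong (𝒩.cong (φ.to-cong x≈y))
  }
  where
  module φ = Automorphism φ
  module 𝒩 = Func 𝒩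

{-# OPTIONS --safe #-}
-- An order automorphism f of Lₙ([0,1]) is continuous.  Indeed x is the least
-- upper bound of its truncated translates x - r (r > 0), hence f x is the least
-- upper bound of the f (x - r).  If the i-th coordinates of all of these were
-- at most (f x)ᵢ - q, then lowering the first i coordinates of f x to (f x)ᵢ - q
-- would give a smaller upper bound.  So (f x)ᵢ - q ≤ (f (x - r))ᵢ ≤ (f z)ᵢ for
-- some r > 0 and all z within r of x; the upper estimate is dual.  As f and its
-- inverse are continuous monotone bijections, conjugation by f preserves each
-- kind of negation.
module Submission where

open import Defs
open import Axiom.ExcludedMiddle using (ExcludedMiddle)
open import Data.Fin.Base as Fin using (Fin; zero; suc)
import Data.Fin.Properties as Finₚ
open import Data.Nat.Base as ℕ using (ℕ; zero; suc; z≤n; s≤s; _≥_)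
import Data.Nat.Properties as ℕₚ
open import Data.Product.Base using (∃; _×_; _,_; proj₁; proj₂)
open import Data.Rational.Base as ℚ using (ℚ; 0ℚ; 1ℚ; ½)
import Data.Rational.Properties as ℚₚ
open import Data.Rational.Solver using (module +-*-Solver)
open import Data.Sum.Base using (inj₁; inj₂)
open import Data.Vec.Functional using (Vector; _∷_; head; tail)
open import Function.Base using (_∘_)
open import Function.Bundles using (Equivalence; Func; Inverse; _⇔_; mk⇔)
open import Function.Properties.Bijection using (Bijection⇒Inverse)
open import Level using (0ℓ)
open import Relation.Binary.Core using (_Preserves_⟶_)
open import Relation.Binary.PropositionalEquality using (_≡_; refl; sym; cong; subst)
open import Relation.Nullary using (¬_; Dec; yes; no; contradiction)
open import Relation.Nullary.Decidable using (decidable-stable)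

open +-*-Solver using (solve; _:=_; _:+_; _:*_; _:-_; :-_; con)

-- Rational numbers

-- Strict order depends only on the difference of the two sides, so every rearrangement of a strict
-- inequality reduces to a ring identity.
<-by-difference : ∀ {p q r s} → q ℚ.- p ≡ s ℚ.- r → p ℚ.< q → r ℚ.< s
<-by-difference {p} {q} {r} {s} eq p<q = begin-strict
  r                    ≡⟨ solve 2 (λ p r → r := p :+ (r :- p)) refl p r ⟩
  p ℚ.+ (r ℚ.- p)      <⟨ ℚₚ.+-monoˡ-< (r ℚ.- p) p<q ⟩
  q ℚ.+ (r ℚ.- p)      ≡⟨ solve 3 (λ p q r → q :+ (r :- p) := (q :- p) :+ r) refl p q r ⟩
  (q ℚ.- p) ℚ.+ r      ≡⟨ cong (ℚ._+ r) eq ⟩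
  (s ℚ.- r) ℚ.+ r      ≡⟨ solve 2 (λ r s → (s :- r) :+ r := s) refl r s ⟩
  s                    ∎
  where open ℚₚ.≤-Reasoning

½-pos : ∀ {ε} → 0ℚ ℚ.< ε → 0ℚ ℚ.< ½ ℚ.* ε
½-pos {ε} 0<ε = subst (ℚ._< ½ ℚ.* ε) (ℚₚ.*-zeroʳ ½) (ℚₚ.*-monoʳ-<-pos ½ 0<ε)

½-< : ∀ {ε} → 0ℚ ℚ.< ε → ½ ℚ.* ε ℚ.< ε
½-< {ε} 0<ε = <-by-difference
  (solve 1 (λ ε → con ½ :* ε :- con 0ℚ := ε :- con ½ :* ε) refl ε) (½-pos 0<ε)

⊓-pos : ∀ {p q} → 0ℚ ℚ.< p → 0ℚ ℚ.< q → 0ℚ ℚ.< p ℚ.⊓ q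
⊓-pos {p} {q} 0<p 0<q with ℚₚ.⊓-sel p q
... | inj₁ eq = subst (0ℚ ℚ.<_) (sym eq) 0<p
... | inj₂ eq = subst (0ℚ ℚ.<_) (sym eq) 0<q

p≤∣p∣ : ∀ p → p ℚ.≤ ℚ.∣ p ∣
p≤∣p∣ p with ℚₚ.≤-total 0ℚ p
... | inj₁ 0≤p = ℚₚ.≤-reflexive (sym (ℚₚ.0≤p⇒∣p∣≡p 0≤p))
... | inj₂ p≤0 = ℚₚ.≤-trans p≤0 (ℚₚ.0≤∣p∣ p)

-p≤∣p∣ : ∀ p → ℚ.- p ℚ.≤ ℚ.∣ p ∣
-p≤∣p∣ p = subst (ℚ.- p ℚ.≤_) (ℚₚ.∣-p∣≡∣p∣ p) (p≤∣p∣ (ℚ.- p))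

∣p∣<ε : ∀ {ε} p → p ℚ.< ε → ℚ.- p ℚ.< ε → ℚ.∣ p ∣ ℚ.< ε
∣p∣<ε p p<ε -p<ε with ℚₚ.∣p∣≡p∨∣p∣≡-p p
... | inj₁ eq = subst (ℚ._< _) (sym eq) p<ε
... | inj₂ eq = subst (ℚ._< _) (sym eq) -p<ε

p<p+ε : ∀ p {ε} → 0ℚ ℚ.< ε → p ℚ.< p ℚ.+ ε
p<p+ε p {ε} = <-by-difference (solve 2 (λ p ε → ε :- con 0ℚ := (p :+ ε) :- p) refl p ε)

∣p-q∣<ε⇒p<q+ε : ∀ {ε} p q → ℚ.∣ p ℚ.- q ∣ ℚ.< ε → p ℚ.< q ℚ.+ ε
∣p-q∣<ε⇒p<q+ε {ε} p q h = <-by-difference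
  (solve 3 (λ p q ε → ε :- (p :- q) := (q :+ ε) :- p) refl p q ε)
  (ℚₚ.≤-<-trans (p≤∣p∣ (p ℚ.- q)) h)

-- Real numbers

eventually₂ : ∀ {P Q R : ℕ → Set} → (∀ n → P n → Q n → R n) →
  Eventually P → Eventually Q → Eventually R
eventually₂ f (M , h) (N , k) = M ℕ.⊔ N , λ {n} l≤n →
  f n (h (ℕₚ.m⊔n≤o⇒m≤o M N l≤n)) (k (ℕₚ.m⊔n≤o⇒n≤o M N l≤n))

eventually₁ : ∀ {P R : ℕ → Set} → (∀ n → P n → R n) → Eventually P → Eventually R
eventually₁ f (M , h) = M , λ {n} M≤n → f n (h M≤n)

≈⇒≤ : ∀ {x y} → x ≈ y → x ≤ y
≈⇒≤ {x} {y} x≈y = mk≤ λ 0<ε →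
  eventually₁ (λ n → ∣p-q∣<ε⇒p<q+ε (seq x n) (seq y n)) (close x≈y 0<ε)

infixl 6 _⊖_

-- Adding `q` is written `x ⊖ (ℚ.- q)`, so that shifts in both directions share one operation.
_⊖_ : ℝ → ℚ → ℝ
x ⊖ q = x - fromℚ q

⊖-mono : ∀ x y q → x ≤ y → x ⊖ q ≤ y ⊖ q
⊖-mono x y q x≤y = mk≤ λ {ε} 0<ε → eventually₁
  (λ n → <-by-difference (solve 4
    (λ x y q ε → (y :+ ε) :- x := (y :- q :+ ε) :- (x :- q)) refl (seq x n) (seq y n) q ε))
  (below x≤y 0<ε)

⊖-anti : ∀ x p q → p ℚ.≤ q → x ⊖ q ≤ x ⊖ p
⊖-anti x p q p≤q = mk≤ λ {ε} 0<ε → 0 , λ {n} _ → ℚₚ.≤-<-trans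
  (ℚₚ.+-monoʳ-≤ (seq x n) (ℚₚ.neg-antimono-≤ p≤q)) (p<p+ε (seq x n ℚ.- p) 0<ε)

⊖-adjointˡ : ∀ x y q → x ⊖ q ≤ y → x ≤ y ⊖ (ℚ.- q)
⊖-adjointˡ x y q h = mk≤ λ {ε} 0<ε → eventually₁
  (λ n → <-by-difference (solve 4
    (λ x y q ε → (y :+ ε) :- (x :- q) := (y :- (:- q) :+ ε) :- x) refl (seq x n) (seq y n) q ε))
  (below h 0<ε)

⊖-adjointʳ : ∀ x y q → x ≤ y ⊖ (ℚ.- q) → x ⊖ q ≤ y
⊖-adjointʳ x y q h = mk≤ λ {ε} 0<ε → eventually₁
  (λ n → <-by-difference (solve 4
    (λ x y q ε → (y :- (:- q) :+ ε) :- x := (y :+ ε) :- (x :- q)) refl (seq x n) (seq y n) q ε))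
  (below h 0<ε)

x⊖q≤x : ∀ x q → 0ℚ ℚ.≤ q → x ⊖ q ≤ x
x⊖q≤x x q 0≤q = ≤-trans (⊖-anti x 0ℚ q 0≤q) (≈⇒≤ {x ⊖ 0ℚ} {x} (mk≈ λ {ε} 0<ε → 0 , λ {n} _ →
  subst (λ p → ℚ.∣ p ∣ ℚ.< ε) (solve 1 (λ x → con 0ℚ := (x :- con 0ℚ) :- x) refl (seq x n)) 0<ε))

-- Half of the tolerance `ε` pays for the shift, the other half for the slack in the definition of
-- `≤`.
≤-limit : ∀ x y → (∀ q → 0ℚ ℚ.< q → x ⊖ q ≤ y) → x ≤ y
≤-limit x y h = mk≤ λ {ε} 0<ε → eventually₁
  (λ n → <-by-difference (solve 3
    (λ x y ε → (y :+ con ½ :* ε) :- (x :- con ½ :* ε) := (y :+ ε) :- x) refl (seq x n) (seq y n) ε))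
  (below (h (½ ℚ.* ε) (½-pos 0<ε)) (½-pos 0<ε))

x≰x⊖q : ∀ x q → 0ℚ ℚ.< q → ¬ (x ≤ x ⊖ q)
x≰x⊖q x q 0<q h =
  let N , k = below h 0<q in
  ℚₚ.<-irrefl (solve 2 (λ x q → x := x :- q :+ q) refl (seq x N) q) (k ℕₚ.≤-refl)

x⊖-q≰x : ∀ x q → 0ℚ ℚ.< q → ¬ (x ⊖ (ℚ.- q) ≤ x)
x⊖-q≰x x q 0<q h =
  let N , k = below h 0<q in
  ℚₚ.<-irrefl (solve 2 (λ x q → x :- (:- q) := x :+ q) refl (seq x N) q) (k ℕₚ.≤-refl)

x≤x⊖-q : ∀ x q → 0ℚ ℚ.≤ q → x ≤ x ⊖ (ℚ.- q)
x≤x⊖-q x q 0≤q = ⊖-adjointˡ x x q (x⊖q≤x x q 0≤q)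

fromℚ-pos : ∀ {q} → 0ℚ ℚ.< q → 0ℝ < fromℚ q
fromℚ-pos {q} 0<q = ½ ℚ.* q , ½-pos 0<q , 0 , λ _ →
  subst (ℚ._< q) (sym (ℚₚ.+-identityˡ (½ ℚ.* q))) (½-< 0<q)

rational-below : ∀ ε → 0ℝ < ε → ∃ λ q → 0ℚ ℚ.< q × fromℚ q < ε
rational-below ε (d , 0<d , h) = ½ ℚ.* d , ½-pos 0<d , ½ ℚ.* d , ½-pos 0<d ,
  eventually₁ (λ n → <-by-difference (solve 2
    (λ d e → e :- (con 0ℚ :+ d) := e :- (con ½ :* d :+ con ½ :* d)) refl d (seq ε n))) h

-- Nearness of reals

infix 4 _≈[_]_

-- Distance at most `q`, expressed by two order inequalities so that lattice and monotonicity
-- arguments apply without absolute values.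
_≈[_]_ : ℝ → ℚ → ℝ → Set
x ≈[ q ] y = x ⊖ q ≤ y × y ⊖ q ≤ x

∣x-y∣<q⇒≈[] : ∀ x y q → ∣ x - y ∣ < fromℚ q → x ≈[ q ] y
∣x-y∣<q⇒≈[] x y q (d , 0<d , ∣x-y∣+d<q) =
  (mk≤ λ 0<ε → eventually₁ (λ n → above (seq x n) (seq y n) 0<ε) ∣x-y∣+d<q) ,
  (mk≤ λ 0<ε → eventually₁ (λ n → beneath (seq x n) (seq y n) 0<ε) ∣x-y∣+d<q)
  where
  drop-d : ∀ p → p ℚ.+ d ℚ.< q → p ℚ.< q
  drop-d p = ℚₚ.<-trans (p<p+ε p 0<d)
  above : ∀ a b {ε} → 0ℚ ℚ.< ε → ℚ.∣ a ℚ.- b ∣ ℚ.+ d ℚ.< q → a ℚ.- q ℚ.< b ℚ.+ ε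
  above a b 0<ε h = ℚₚ.<-trans
    (<-by-difference (solve 3 (λ a b q → q :- (a :- b) := b :- (a :- q)) refl a b q)
      (ℚₚ.≤-<-trans (p≤∣p∣ (a ℚ.- b)) (drop-d ℚ.∣ a ℚ.- b ∣ h)))
    (p<p+ε b 0<ε)
  beneath : ∀ a b {ε} → 0ℚ ℚ.< ε → ℚ.∣ a ℚ.- b ∣ ℚ.+ d ℚ.< q → b ℚ.- q ℚ.< a ℚ.+ ε
  beneath a b 0<ε h = ℚₚ.<-trans
    (<-by-difference (solve 3 (λ a b q → q :- (:- (a :- b)) := a :- (b :- q)) refl a b q)
      (ℚₚ.≤-<-trans (-p≤∣p∣ (a ℚ.- b)) (drop-d ℚ.∣ a ℚ.- b ∣ h)))
    (p<p+ε a 0<ε)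

-- The gap `d` between `q` and `ε` is halved: one half absorbs the slack in `≤`, the other remains
-- to witness the strict inequality.
≈[]⇒∣x-y∣<ε : ∀ x y q ε → fromℚ q < ε → x ≈[ q ] y → ∣ x - y ∣ < ε
≈[]⇒∣x-y∣<ε x y q ε (d , 0<d , q+d<ε) (x-q≤y , y-q≤x) =
  η , ½-pos 0<d , eventually₂ (λ n → bound (seq x n ℚ.- seq y n)) ∣x-y∣<q+η q+d<ε
  where
  η = ½ ℚ.* d
  ∣x-y∣<q+η : Eventually λ n → ℚ.∣ seq x n ℚ.- seq y n ∣ ℚ.< q ℚ.+ η
  ∣x-y∣<q+η = eventually₂
    (λ n h k → ∣p∣<ε (seq x n ℚ.- seq y n) (above (seq x n) (seq y n) h) (beneath (seq x n) (seq y n) k))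
    (below x-q≤y (½-pos 0<d)) (below y-q≤x (½-pos 0<d))
    where
    above : ∀ a b → a ℚ.- q ℚ.< b ℚ.+ η → a ℚ.- b ℚ.< q ℚ.+ η
    above a b = <-by-difference (solve 4
      (λ a b q η → (b :+ η) :- (a :- q) := (q :+ η) :- (a :- b)) refl a b q η)
    beneath : ∀ a b → b ℚ.- q ℚ.< a ℚ.+ η → ℚ.- (a ℚ.- b) ℚ.< q ℚ.+ η
    beneath a b = <-by-difference (solve 4
      (λ a b q η → (a :+ η) :- (b :- q) := (q :+ η) :- (:- (a :- b))) refl a b q η)
  bound : ∀ p {e} → ℚ.∣ p ∣ ℚ.< q ℚ.+ η → q ℚ.+ d ℚ.< e → ℚ.∣ p ∣ ℚ.+ η ℚ.< e
  bound p h = ℚₚ.<-trans (<-by-difference (solve 3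
    (λ a q d → (q :+ con ½ :* d) :- a := (q :+ d) :- (a :+ con ½ :* d)) refl ℚ.∣ p ∣ q d) h)

⊓-mono-⊖ : ∀ x x′ y y′ q → x ⊖ q ≤ x′ → y ⊖ q ≤ y′ → x ⊓ y ⊖ q ≤ x′ ⊓ y′
⊓-mono-⊖ x x′ y y′ q h k = ⊓-glb {x′} {y′}
  (≤-trans (⊖-mono (x ⊓ y) x q (x⊓y≤x x y)) h) (≤-trans (⊖-mono (x ⊓ y) y q (x⊓y≤y x y)) k)

-- The shift is moved to the right by adjointness, because `⊔-lub` needs a bare join on the left.
⊔-mono-⊖ : ∀ x x′ y y′ q → x ⊖ q ≤ x′ → y ⊖ q ≤ y′ → (x ⊔ y) ⊖ q ≤ x′ ⊔ y′
⊔-mono-⊖ x x′ y y′ q h k = ⊖-adjointʳ (x ⊔ y) (x′ ⊔ y′) q (⊔-lub {x} {y}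
  (⊖-adjointˡ x (x′ ⊔ y′) q (≤-trans h (x≤x⊔y x′ y′)))
  (⊖-adjointˡ y (x′ ⊔ y′) q (≤-trans k (y≤x⊔y x′ y′))))

⊓-monoˡ : ∀ x y z → x ≤ y → x ⊓ z ≤ y ⊓ z
⊓-monoˡ x y z x≤y = ⊓-glb (≤-trans (x⊓y≤x x z) x≤y) (x⊓y≤y x z)

⊔-monoˡ : ∀ x y z → x ≤ y → x ⊔ z ≤ y ⊔ z
⊔-monoˡ x y z x≤y = ⊔-lub (≤-trans x≤y (x≤x⊔y y z)) (y≤x⊔y y z)

-- Clamping to the unit interval

clamp : ℝ → I
clamp x = mkI ((x ⊔ 0ℝ) ⊓ 1ℝ)
  (⊓-glb (y≤x⊔y x 0ℝ) (0≤ 1ᴵ)) (x⊓y≤y (x ⊔ 0ℝ) 1ℝ)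

clamp-mono : ∀ x y → x ≤ y → clamp x ≤ᴵ clamp y
clamp-mono x y x≤y = ⊓-monoˡ (x ⊔ 0ℝ) (y ⊔ 0ℝ) 1ℝ (⊔-monoˡ x y 0ℝ x≤y)

x≤clamp : ∀ x → x ≤ 1ℝ → x ≤ value (clamp x)
x≤clamp x x≤1 = ⊓-glb (x≤x⊔y x 0ℝ) x≤1

clamp≤x : ∀ x → 0ℝ ≤ x → value (clamp x) ≤ x
clamp≤x x 0≤x = ≤-trans (x⊓y≤x (x ⊔ 0ℝ) 1ℝ) (⊔-lub ≤-refl 0≤x)

clamp-least : ∀ x (z : I) → x ≤ value z → clamp x ≤ᴵ z
clamp-least x z x≤z = ≤-trans (x⊓y≤x (x ⊔ 0ℝ) 1ℝ) (⊔-lub x≤z (0≤ z))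

clamp-greatest : ∀ x (z : I) → value z ≤ x → z ≤ᴵ clamp x
clamp-greatest x z z≤x = ⊓-glb (≤-trans z≤x (x≤x⊔y x 0ℝ)) (≤1 z)

-- Sorting

module _ (R : I → I → Set)
  (R-⊓ : ∀ x x′ y y′ → R x x′ → R y y′ → R (x ⊓ᴵ y) (x′ ⊓ᴵ y′))
  (R-⊔ : ∀ x x′ y y′ → R x x′ → R y y′ → R (x ⊔ᴵ y) (x′ ⊔ᴵ y′)) where

  -- Insertion uses only `⊓ᴵ` and `⊔ᴵ` and never branches on the order, so a relation respected by
  -- both passes through coordinatewise.
  insert-preserves : ∀ {n} x x′ (ys ys′ : Vector I n) → R x x′ → (∀ i → R (ys i) (ys′ i)) →
    ∀ i → R (insert x ys i) (insert x′ ys′ i)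
  insert-preserves {zero}  x x′ ys ys′ r rs zero    = r
  insert-preserves {suc n} x x′ ys ys′ r rs zero    = R-⊓ x x′ (head ys) (head ys′) r (rs zero)
  insert-preserves {suc n} x x′ ys ys′ r rs (suc i) =
    insert-preserves (x ⊔ᴵ head ys) (x′ ⊔ᴵ head ys′) (tail ys) (tail ys′)
      (R-⊔ x x′ (head ys) (head ys′) r (rs zero)) (rs ∘ suc) i

  sort-preserves : ∀ {n} (xs xs′ : Vector I n) → (∀ i → R (xs i) (xs′ i)) →
    ∀ i → R (sort xs i) (sort xs′ i)
  sort-preserves {suc n} xs xs′ rs =
    insert-preserves (head xs) (head xs′) (sort (tail xs)) (sort (tail xs′)) (rs zero)
      (sort-preserves (tail xs) (tail xs′) (rs ∘ suc))

-- The first exchange leaves `x` in front and carries on `x ⊔ᴵ head ys`, which equals `head ys` and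
-- is again below the remaining entries.
insert-least : ∀ {n} x (ys : Vector I n) → ys Preserves Fin._≤_ ⟶ _≤ᴵ_ →
  (∀ i → x ≤ᴵ ys i) → ∀ i → insert x ys i ≈ᴵ (x ∷ ys) i
insert-least {zero}  x ys ys↑ x≤ys zero = ≈-refl
insert-least {suc n} x ys ys↑ x≤ys zero = ≤-antisym (x⊓y≤x a b) (⊓-glb ≤-refl (x≤ys zero))
  where
  a = value x
  b = value (head ys)
insert-least {suc n} x ys ys↑ x≤ys (suc i) = ≈-trans
  (insert-least (x ⊔ᴵ head ys) (tail ys) (λ i≤j → ys↑ (s≤s i≤j))
    (λ j → ⊔-lub (x≤ys (suc j)) (ys↑ z≤n)) i)
  (x⊔ys≈ys i)
  where
  x⊔ys≈ys : ∀ i → ((x ⊔ᴵ head ys) ∷ tail ys) i ≈ᴵ ys i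
  x⊔ys≈ys zero    = ≤-antisym (⊔-lub (x≤ys zero) ≤-refl) (y≤x⊔y (value x) (value (head ys)))
  x⊔ys≈ys (suc j) = ≈-refl

sort-increasing-id : ∀ {n} (xs : Vector I n) → xs Preserves Fin._≤_ ⟶ _≤ᴵ_ →
  ∀ i → sort xs i ≈ᴵ xs i
sort-increasing-id {suc n} xs xs↑ i = ≈-trans
  (insert-least (head xs) (sort (tail xs)) (sort-increasing (tail xs))
    (λ j → ≤-trans (xs↑ z≤n) (≈⇒≤ (≈-sym (ih j)))) i)
  (head∷sort≈xs i)
  where
  ih : ∀ j → sort (tail xs) j ≈ᴵ xs (suc j)
  ih = sort-increasing-id (tail xs) (λ i≤j → xs↑ (s≤s i≤j))
  head∷sort≈xs : ∀ i → (head xs ∷ sort (tail xs)) i ≈ᴵ xs i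
  head∷sort≈xs zero    = ≈-refl
  head∷sort≈xs (suc j) = ih j

ρ∘σ : ∀ {n} (x : L n) → ρ (σ x) ≈ᴸ x
ρ∘σ x = sort-increasing-id (coords x) (increasing x)

-- Continuity on Lₙ([0,1])

Near : ∀ {n} → ℚ → Vector I n → Vector I n → Set
Near q x y = ∀ i → value (x i) ≈[ q ] value (y i)

-- Minimum and maximum are nonexpansive for the maximum distance, hence so is sorting.
sort-near : ∀ {n} q (xs ys : Vector I n) → Near q xs ys → Near q (sort xs) (sort ys)
sort-near q = sort-preserves (λ x y → value x ≈[ q ] value y)
  (λ (mkI x _ _) (mkI x′ _ _) (mkI y _ _) (mkI y′ _ _) (a , b) (c , d) →
    ⊓-mono-⊖ x x′ y y′ q a c , ⊓-mono-⊖ x′ x y′ y q b d)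
  (λ (mkI x _ _) (mkI x′ _ _) (mkI y _ _) (mkI y′ _ _) (a , b) (c , d) →
    ⊔-mono-⊖ x x′ y y′ q a c , ⊔-mono-⊖ x′ x y′ y q b d)

near-resp : ∀ {n} q (x x′ y y′ : Vector I n) → (∀ i → x i ≈ᴵ x′ i) → (∀ i → y i ≈ᴵ y′ i) →
  Near q x y → Near q x′ y′
near-resp q x x′ y y′ x≈x′ y≈y′ h i =
  ≤-trans (⊖-mono (value (x′ i)) (value (x i)) q (≈⇒≤ (≈-sym (x≈x′ i))))
    (≤-trans (proj₁ (h i)) (≈⇒≤ (y≈y′ i))) ,
  ≤-trans (⊖-mono (value (y′ i)) (value (y i)) q (≈⇒≤ (≈-sym (y≈y′ i))))
    (≤-trans (proj₂ (h i)) (≈⇒≤ (x≈x′ i)))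

-- Unlike `IsContinuous`, this form composes directly, since no sorting stands between the maps.
Continuousᴸ : ∀ {n} → (L n → L n) → Set
Continuousᴸ F = ∀ x {q} → 0ℚ ℚ.< q → ∃ λ r → 0ℚ ℚ.< r ×
  ∀ y → Near r (coords x) (coords y) → Near q (coords (F x)) (coords (F y))

continuousᴸ-∘ : ∀ {n} {F G : L n → L n} → Continuousᴸ F → Continuousᴸ G → Continuousᴸ (F ∘ G)
continuousᴸ-∘ {G = G} F-cont G-cont x 0<q =
  let _ , 0<r , F-near = F-cont (G x) 0<q
      s , 0<s , G-near = G-cont x 0<r
  in s , 0<s , λ y x~y → F-near (G y) (G-near y x~y)

continuousᴸ-resp : ∀ {n} (F G : L n → L n) → (∀ x → F x ≈ᴸ G x) → Continuousᴸ F → Continuousᴸ G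
continuousᴸ-resp F G F≈G F-cont x {q} 0<q =
  let r , 0<r , F-near = F-cont x 0<q in
  r , 0<r , λ y x~y → near-resp q (σ (F x)) (σ (G x)) (σ (F y)) (σ (G y))
    (F≈G x) (F≈G y) (F-near y x~y)

-- Increasing tuples are points of the cube that sorting fixes up to `≈ᴸ`; compatibility of `F` with
-- equality then removes the sorting.
isContinuous⇒continuousᴸ : ∀ {n} (F : L n → L n) → (∀ {x y} → x ≈ᴸ y → F x ≈ᴸ F y) →
  IsContinuous F → Continuousᴸ F
isContinuous⇒continuousᴸ F F-cong F-cont x {q} 0<q =
  let δ , 0<δ , F-near = F-cont (σ x) (fromℚ q) (fromℚ-pos 0<q)
      r , 0<r , r<δ    = rational-below δ 0<δ
  in r , 0<r , λ y x~y →
       near-resp q (σ (F (ρ (σ x)))) (σ (F x)) (σ (F (ρ (σ y)))) (σ (F y))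
         (F-cong {ρ (σ x)} {x} (ρ∘σ x)) (F-cong {ρ (σ y)} {y} (ρ∘σ y))
         (λ i → ∣x-y∣<q⇒≈[] (value (σ (F (ρ (σ x))) i)) (value (σ (F (ρ (σ y))) i)) q
           (F-near (σ y) (λ j → ≈[]⇒∣x-y∣<ε (value (σ x j)) (value (σ y j)) r δ r<δ (x~y j)) i))

-- As sorting is nonexpansive, a radius that works at `ρ x` works at `x`.
continuousᴸ⇒isContinuous : ∀ {n} (F : L n → L n) → Continuousᴸ F → IsContinuous F
continuousᴸ⇒isContinuous F F-cont x ε 0<ε =
  let q , 0<q , q<ε    = rational-below ε 0<ε
      r , 0<r , F-near = F-cont (ρ x) 0<q
  in fromℚ r , fromℚ-pos 0<r , λ y x~y i →
       ≈[]⇒∣x-y∣<ε (value (σ (F (ρ x)) i)) (value (σ (F (ρ y)) i)) q ε q<ε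
         (F-near (ρ y)
           (sort-near r x y (λ j → ∣x-y∣<q⇒≈[] (value (x j)) (value (y j)) r (x~y j))) i)

-- Order isomorphisms of Lₙ([0,1])

≈ᴸ⇒≤ᴸ : ∀ {n} (x y : L n) → x ≈ᴸ y → x ≤ᴸ y
≈ᴸ⇒≤ᴸ x y x≈y i = ≈⇒≤ (x≈y i)

translate : ∀ {n} → ℚ → L n → L n
translate r x = mkL (λ i → clamp (xs i ⊖ r))
  (λ {i} {j} i≤j → clamp-mono (xs i ⊖ r) (xs j ⊖ r) (⊖-mono (xs i) (xs j) r (increasing x i≤j)))
  where
  xs = λ i → value (coords x i)

-- The greatest element below `x` with `i`-th coordinate at most `c`; the earlier coordinates are
-- capped as well to keep the tuple increasing.
lowerUpTo : ∀ {n} → Fin n → I → L n → L n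
lowerUpTo i c x = mkL (λ j → u (j Finₚ.≤? i)) (λ {j} {k} → u-mono (j Finₚ.≤? i) (k Finₚ.≤? i))
  where
  u : ∀ {j} → Dec (j Fin.≤ i) → I
  u {j} (yes _) = coords x j ⊓ᴵ c
  u {j} (no  _) = coords x j
  u-mono : ∀ {j k} (d : Dec (j Fin.≤ i)) (e : Dec (k Fin.≤ i)) → j Fin.≤ k → u d ≤ᴵ u e
  u-mono {j} {k} (yes _) (yes _) j≤k =
    ⊓-monoˡ (value (coords x j)) (value (coords x k)) (value c) (increasing x j≤k)
  u-mono {j} (yes _) (no _)  j≤k = ≤-trans (x⊓y≤x (value (coords x j)) (value c)) (increasing x j≤k)
  u-mono {j} {k} (no j≰i) (yes k≤i) j≤k = contradiction (Finₚ.≤-trans {i = j} {k} {i} j≤k k≤i) j≰i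
  u-mono (no _)    (no _)    j≤k = increasing x j≤k

lowerUpTo-greatest : ∀ {n} i c (x y : L n) → y ≤ᴸ x → coords y i ≤ᴵ c → y ≤ᴸ lowerUpTo i c x
lowerUpTo-greatest i c x y y≤x yᵢ≤c j with j Finₚ.≤? i
... | yes j≤i = ⊓-glb (y≤x j) (≤-trans (increasing y j≤i) yᵢ≤c)
... | no  _   = y≤x j

lowerUpTo-≤ : ∀ {n} i c (x : L n) → coords (lowerUpTo i c x) i ≤ᴵ c
lowerUpTo-≤ i c x with i Finₚ.≤? i
... | yes _   = x⊓y≤y (value (coords x i)) (value c)
... | no  i≰i = contradiction (ℕₚ.≤-refl {Fin.toℕ i}) i≰i

-- Order dual of `lowerUpTo`: the least element above `x` with `i`-th coordinate at least `c`.
raiseFrom : ∀ {n} → Fin n → I → L n → L n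
raiseFrom i c x = mkL (λ j → u (i Finₚ.≤? j)) (λ {j} {k} → u-mono (i Finₚ.≤? j) (i Finₚ.≤? k))
  where
  u : ∀ {j} → Dec (i Fin.≤ j) → I
  u {j} (yes _) = coords x j ⊔ᴵ c
  u {j} (no  _) = coords x j
  u-mono : ∀ {j k} (d : Dec (i Fin.≤ j)) (e : Dec (i Fin.≤ k)) → j Fin.≤ k → u d ≤ᴵ u e
  u-mono {j} {k} (yes _) (yes _) j≤k =
    ⊔-monoˡ (value (coords x j)) (value (coords x k)) (value c) (increasing x j≤k)
  u-mono {k = k} (no _) (yes _) j≤k = ≤-trans (increasing x j≤k) (x≤x⊔y (value (coords x k)) (value c))
  u-mono {j} {k} (yes i≤j) (no i≰k) j≤k = contradiction (Finₚ.≤-trans {i = i} {j} {k} i≤j j≤k) i≰k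
  u-mono (no _)    (no _)    j≤k = increasing x j≤k

raiseFrom-least : ∀ {n} i c (x y : L n) → x ≤ᴸ y → c ≤ᴵ coords y i → raiseFrom i c x ≤ᴸ y
raiseFrom-least i c x y x≤y c≤yᵢ j with i Finₚ.≤? j
... | yes i≤j = ⊔-lub (x≤y j) (≤-trans c≤yᵢ (increasing y i≤j))
... | no  _   = x≤y j

raiseFrom-≥ : ∀ {n} i c (x : L n) → c ≤ᴵ coords (raiseFrom i c x) i
raiseFrom-≥ i c x with i Finₚ.≤? i
... | yes _   = y≤x⊔y (value (coords x i)) (value c)
... | no  i≰i = contradiction (ℕₚ.≤-refl {Fin.toℕ i}) i≰i

-- Finitely many positive radii have a positive minimum, which serves every index because `P i`
-- passes to smaller radii. The empty minimum is set to 1.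
uniform : ∀ {n} (P : Fin n → ℚ → Set) → (∀ i {r s} → r ℚ.≤ s → P i s → P i r) →
  (∀ i → ∃ λ r → 0ℚ ℚ.< r × P i r) → ∃ λ r → 0ℚ ℚ.< r × ∀ i → P i r
uniform {zero}  P anti h = 1ℚ , ℚₚ.positive⁻¹ 1ℚ , λ ()
uniform {suc n} P anti h =
  let r , 0<r , Pr = h zero
      s , 0<s , Ps = uniform (P ∘ suc) (anti ∘ suc) (h ∘ suc)
  in r ℚ.⊓ s , ⊓-pos 0<r 0<s , λ where
    zero    → anti zero (ℚₚ.p⊓q≤p r s) Pr
    (suc i) → anti (suc i) (ℚₚ.p⊓q≤q r s) (Ps i)

-- Symmetric in `to` and `from`, so that every fact about `to` holds for `from` by way of `inverse`.
record OrderIso (n : ℕ) : Set where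
  field
    to from   : L n → L n
    to-mono   : ∀ x y → x ≤ᴸ y → to x ≤ᴸ to y
    from-mono : ∀ x y → x ≤ᴸ y → from x ≤ᴸ from y
    to∘from   : ∀ x → to (from x) ≈ᴸ x
    from∘to   : ∀ x → from (to x) ≈ᴸ x

  to-cong : ∀ x y → x ≈ᴸ y → to x ≈ᴸ to y
  to-cong x y x≈y i = ≤-antisym
    (to-mono x y (≈ᴸ⇒≤ᴸ x y x≈y) i) (to-mono y x (≈ᴸ⇒≤ᴸ y x (λ i → ≈-sym (x≈y i))) i)

  ≤from : ∀ x y → to x ≤ᴸ y → x ≤ᴸ from y
  ≤from x y h i = ≤-trans (≈⇒≤ (≈-sym (from∘to x i))) (from-mono (to x) y h i)

  from≤ : ∀ x y → y ≤ᴸ to x → from y ≤ᴸ x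
  from≤ x y h i = ≤-trans (from-mono y (to x) h i) (≈⇒≤ (from∘to x i))

  -- Monotonicity applied to `/ 0ᴵ / ≤ᴸ from / 0ᴵ /` bounds the image of the least element by
  -- `/ 0ᴵ /`.
  to-/0/ : to / 0ᴵ / ≈ᴸ / 0ᴵ /
  to-/0/ i = ≤-antisym
    (≤-trans (to-mono / 0ᴵ / (from / 0ᴵ /) (λ j → 0≤ (coords (from / 0ᴵ /) j)) i)
             (≈⇒≤ (to∘from / 0ᴵ / i)))
    (0≤ (coords (to / 0ᴵ /) i))

  to-/1/ : to / 1ᴵ / ≈ᴸ / 1ᴵ /
  to-/1/ i = ≤-antisym
    (≤1 (coords (to / 1ᴵ /) i))
    (≤-trans (≈⇒≤ (≈-sym (to∘from / 1ᴵ / i)))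
             (to-mono (from / 1ᴵ /) / 1ᴵ / (λ j → ≤1 (coords (from / 1ᴵ /) j)) i))

inverse : ∀ {n} → OrderIso n → OrderIso n
inverse φ = record
  { to = from ; from = to ; to-mono = from-mono ; from-mono = to-mono
  ; to∘from = from∘to ; from∘to = to∘from }
  where open OrderIso φ

to-strictMono : ∀ {n} (φ : OrderIso n) → ∀ x y → x <ᴸ y →
  OrderIso.to φ x <ᴸ OrderIso.to φ y
to-strictMono φ x y (x≤y , x≉y) = to-mono x y x≤y , λ tx≈ty → x≉y λ i →
  ≈-trans (≈-sym (from∘to x i))
    (≈-trans (OrderIso.to-cong (inverse φ) (to x) (to y) tx≈ty i) (from∘to y i))
  where open OrderIso φ

-- Continuity of order isomorphisms

≰⇒≥ : ExcludedMiddle 0ℓ → ∀ x y → ¬ (x ≤ y) → y ≤ x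
≰⇒≥ em x y x≰y with ≤-total em x y
... | inj₁ x≤y = contradiction x≤y x≰y
... | inj₂ y≤x = y≤x

translate-≤ : ∀ {n} (x : L n) r → 0ℚ ℚ.≤ r → translate r x ≤ᴸ x
translate-≤ x r 0≤r j = clamp-least (v ⊖ r) (coords x j) (x⊖q≤x v r 0≤r)
  where v = value (coords x j)

translate-≥ : ∀ {n} (x : L n) r → 0ℚ ℚ.≤ r → x ≤ᴸ translate (ℚ.- r) x
translate-≥ x r 0≤r j = clamp-greatest (v ⊖ (ℚ.- r)) (coords x j) (x≤x⊖-q v r 0≤r)
  where v = value (coords x j)

translate-anti : ∀ {n} (x : L n) r s → r ℚ.≤ s → translate s x ≤ᴸ translate r x
translate-anti x r s r≤s j = clamp-mono (v ⊖ s) (v ⊖ r) (⊖-anti v r s r≤s)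
  where v = value (coords x j)

-- Clamping can only raise `v ⊖ r`, as this is at most 1 already; so `y` dominates every `v ⊖ r`,
-- and `≤-limit` applies.
translates-sup : ∀ {n} (x y : L n) → (∀ r → 0ℚ ℚ.< r → translate r x ≤ᴸ y) → x ≤ᴸ y
translates-sup x y h j = ≤-limit v (value (coords y j)) λ r 0<r → ≤-trans
  (x≤clamp (v ⊖ r) (≤-trans (x⊖q≤x v r (ℚₚ.<⇒≤ 0<r)) (≤1 (coords x j)))) (h r 0<r j)
  where v = value (coords x j)

translates-inf : ∀ {n} (x y : L n) → (∀ r → 0ℚ ℚ.< r → y ≤ᴸ translate (ℚ.- r) x) → y ≤ᴸ x
translates-inf x y h j = ≤-limit (value (coords y j)) v λ r 0<r →
  ⊖-adjointʳ (value (coords y j)) v r (≤-trans (h r 0<r j)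
    (clamp≤x (v ⊖ (ℚ.- r)) (≤-trans (0≤ (coords x j)) (x≤x⊖-q v r (ℚₚ.<⇒≤ 0<r)))))
  where v = value (coords x j)

module _ {n : ℕ} (φ : OrderIso n) where
  open OrderIso φ

  to-lower : ExcludedMiddle 0ℓ → ∀ x q → 0ℚ ℚ.< q → ∀ i → ∃ λ r → 0ℚ ℚ.< r ×
    value (coords (to x) i) ⊖ q ≤ value (coords (to (translate r x)) i)
  to-lower em x q 0<q i = decidable-stable em refute
    where
    refute : ¬ ¬ (∃ λ r → 0ℚ ℚ.< r ×
      value (coords (to x) i) ⊖ q ≤ value (coords (to (translate r x)) i))
    -- If no radius works, `to x` lies below its own lowering `u`, whose `i`-th coordinate is at
    -- most `v ⊖ q`.
    refute ¬p = x≰x⊖q v q 0<q (≤-trans (tox≤u i) (lowerUpTo-≤ i c (to x)))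
      where
      v = value (coords (to x) i)
      w : ℚ → ℝ
      w r = value (coords (to (translate r x)) i)
      small : ∀ r → 0ℚ ℚ.< r → w r ≤ v ⊖ q
      small r 0<r = ≰⇒≥ em (v ⊖ q) (w r) λ h → ¬p (r , 0<r , h)
      c : I
      c = mkI (v ⊖ q)
        -- `v ⊖ q` is nonnegative because it bounds a coordinate of some image; the radius 1 is an
        -- arbitrary choice.
        (≤-trans (0≤ (coords (to (translate 1ℚ x)) i)) (small 1ℚ (ℚₚ.positive⁻¹ 1ℚ)))
        (≤-trans (x⊖q≤x v q (ℚₚ.<⇒≤ 0<q)) (≤1 (coords (to x) i)))
      u : L n
      u = lowerUpTo i c (to x)
      below-u : ∀ r → 0ℚ ℚ.< r → to (translate r x) ≤ᴸ u
      below-u r 0<r = lowerUpTo-greatest i c (to x) (to (translate r x))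
        (to-mono (translate r x) x (translate-≤ x r (ℚₚ.<⇒≤ 0<r))) (small r 0<r)
      tox≤u : to x ≤ᴸ u
      -- The supremum is known for `x`, not for `to x`, so the bound `u` is pulled back along `from`
      -- and compared there.
      tox≤u j = ≤-trans
        (to-mono x (from u) (translates-sup x (from u) λ r 0<r →
          ≤from (translate r x) u (below-u r 0<r)) j)
        (≈⇒≤ (to∘from u j))

  -- Order dual of `to-lower`: `x` is the infimum of its upward translates, and `raiseFrom` supplies
  -- the larger lower bound.
  to-upper : ExcludedMiddle 0ℓ → ∀ x q → 0ℚ ℚ.< q → ∀ i → ∃ λ r → 0ℚ ℚ.< r ×
    value (coords (to (translate (ℚ.- r) x)) i) ≤ value (coords (to x) i) ⊖ (ℚ.- q)
  to-upper em x q 0<q i = decidable-stable em refute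
    where
    refute : ¬ ¬ (∃ λ r → 0ℚ ℚ.< r ×
      value (coords (to (translate (ℚ.- r) x)) i) ≤ value (coords (to x) i) ⊖ (ℚ.- q))
    refute ¬p = x⊖-q≰x v q 0<q (≤-trans (raiseFrom-≥ i c (to x)) (u≤tox i))
      where
      v = value (coords (to x) i)
      w : ℚ → ℝ
      w r = value (coords (to (translate (ℚ.- r) x)) i)
      large : ∀ r → 0ℚ ℚ.< r → v ⊖ (ℚ.- q) ≤ w r
      large r 0<r = ≰⇒≥ em (w r) (v ⊖ (ℚ.- q)) λ h → ¬p (r , 0<r , h)
      c : I
      c = mkI (v ⊖ (ℚ.- q))
        (≤-trans (0≤ (coords (to x) i)) (x≤x⊖-q v q (ℚₚ.<⇒≤ 0<q)))
        (≤-trans (large 1ℚ (ℚₚ.positive⁻¹ 1ℚ)) (≤1 (coords (to (translate (ℚ.- 1ℚ) x)) i)))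
      u : L n
      u = raiseFrom i c (to x)
      above-u : ∀ r → 0ℚ ℚ.< r → u ≤ᴸ to (translate (ℚ.- r) x)
      above-u r 0<r = raiseFrom-least i c (to x) (to (translate (ℚ.- r) x))
        (to-mono x (translate (ℚ.- r) x) (translate-≥ x r (ℚₚ.<⇒≤ 0<r))) (large r 0<r)
      u≤tox : u ≤ᴸ to x
      u≤tox j = ≤-trans
        (≈⇒≤ (≈-sym (to∘from u j)))
        (to-mono (from u) x (translates-inf x (from u) λ r 0<r →
          from≤ (translate (ℚ.- r) x) u (above-u r 0<r)) j)

  to-continuous : ExcludedMiddle 0ℓ → Continuousᴸ to
  to-continuous em x {q} 0<q =
    let r , 0<r , lower = uniform
          (λ i r → value (coords (to x) i) ⊖ q ≤ value (coords (to (translate r x)) i))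
          (λ i {r} {s} r≤s h → ≤-trans h
            (to-mono (translate s x) (translate r x) (translate-anti x r s r≤s) i))
          (to-lower em x q 0<q)
        s , 0<s , upper = uniform
          (λ i s → value (coords (to (translate (ℚ.- s) x)) i) ≤ value (coords (to x) i) ⊖ (ℚ.- q))
          (λ i {r} {s} r≤s h → ≤-trans (to-mono (translate (ℚ.- r) x) (translate (ℚ.- s) x)
            (translate-anti x (ℚ.- s) (ℚ.- r) (ℚₚ.neg-antimono-≤ r≤s)) i) h)
          (to-upper em x q 0<q)
    -- A point `y` this near to `x` lies between `translate r x` and `translate (ℚ.- s) x`, and
    -- monotonicity squeezes its image.
    in r ℚ.⊓ s , ⊓-pos 0<r 0<s , λ y x~y i →
      ≤-trans (lower i) (to-mono (translate r x) y (λ j → clamp-least (v x j ⊖ r) (coords y j)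
        (≤-trans (⊖-anti (v x j) (r ℚ.⊓ s) r (ℚₚ.p⊓q≤p r s)) (proj₁ (x~y j)))) i) ,
      ⊖-adjointʳ (v (to y) i) (v (to x) i) q (≤-trans
        (to-mono y (translate (ℚ.- s) x) (λ j → clamp-greatest (v x j ⊖ (ℚ.- s)) (coords y j)
          (⊖-adjointˡ (v y j) (v x j) s
            (≤-trans (⊖-anti (v y j) (r ℚ.⊓ s) s (ℚₚ.p⊓q≤q r s)) (proj₂ (x~y j))))) i)
        (upper i))
    where
    v : L n → Fin n → ℝ
    v x i = value (coords x i)

orderIso : ∀ {n} → Automorphism n → OrderIso n
orderIso φ = record
  { to        = to
  ; from      = from
  ; to-mono   = λ x y → Equivalence.to (≤-⇔ x y)
  -- The inverse is monotone because an automorphism also reflects the order.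
  ; from-mono = λ x y x≤y → Equivalence.from (≤-⇔ (from x) (from y)) λ i →
      ≤-trans (≈⇒≤ (to∘from x i)) (≤-trans (x≤y i) (≈⇒≤ (≈-sym (to∘from y i))))
  ; to∘from   = to∘from
  ; from∘to   = Inverse.strictlyInverseʳ (Bijection⇒Inverse bijection)
  }
  where
  open Automorphism φ
  to∘from : ∀ x → to (from x) ≈ᴸ x
  to∘from = Inverse.strictlyInverseˡ (Bijection⇒Inverse bijection)

-- Conjugation

-- `ℳ` is a conjugate of `𝒩` only up to pointwise equality, so that the roles of `𝒩` and `𝒩 ^ φ` can
-- be exchanged and each transfer serves both directions.
module Conjugate {n : ℕ} (φ : OrderIso n) (𝒩 ℳ : Endo n)
  (conj : ∀ x → Func.to ℳ x ≈ᴸ OrderIso.from φ (Func.to 𝒩 (OrderIso.to φ x))) where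
  open OrderIso φ
  open Func 𝒩 using () renaming (to to N; cong to N-cong)
  open Func ℳ using () renaming (to to M)

  isFuzzyNegation⁺ : IsFuzzyNegation 𝒩 → IsFuzzyNegation ℳ
  isFuzzyNegation⁺ neg = record
    { N-/0/ = λ i → ≈-trans (conj / 0ᴵ / i)
        (≈-trans (from-cong (N (to / 0ᴵ /)) (N / 0ᴵ /) (N-cong {to / 0ᴵ /} {/ 0ᴵ /} to-/0/) i)
        (≈-trans (from-cong (N / 0ᴵ /) / 1ᴵ / N-/0/ i) (from-/1/ i)))
    ; N-/1/ = λ i → ≈-trans (conj / 1ᴵ / i)
        (≈-trans (from-cong (N (to / 1ᴵ /)) (N / 1ᴵ /) (N-cong {to / 1ᴵ /} {/ 1ᴵ /} to-/1/) i)
        (≈-trans (from-cong (N / 1ᴵ /) / 0ᴵ / N-/1/ i) (from-/0/ i)))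
    ; antitone = λ x y x≤y i → ≤-trans (≈⇒≤ (conj y i))
        (≤-trans (from-mono (N (to y)) (N (to x)) (antitone (to x) (to y) (to-mono x y x≤y)) i)
                 (≈⇒≤ (≈-sym (conj x i))))
    }
    where
    open IsFuzzyNegation neg
    open OrderIso (inverse φ) using ()
      renaming (to-cong to from-cong; to-/0/ to from-/0/; to-/1/ to from-/1/)

  isStrictFuzzyNegation⁺ : ExcludedMiddle 0ℓ → IsStrictFuzzyNegation 𝒩 → IsStrictFuzzyNegation ℳ
  isStrictFuzzyNegation⁺ em strict = record
    { isFuzzyNegation = isFuzzyNegation⁺ isFuzzyNegation
    ; continuous = continuousᴸ⇒isContinuous M
        (continuousᴸ-resp (from ∘ N ∘ to) M (λ x i → ≈-sym (conj x i))
          (continuousᴸ-∘ {F = from} {N ∘ to} (to-continuous (inverse φ) em)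
            (continuousᴸ-∘ {F = N} {to}
              (isContinuous⇒continuousᴸ N (λ {x} {y} → N-cong {x} {y}) continuous)
              (to-continuous φ em))))
    ; strictlyDecreasing = λ x y y<x →
        let p , ≉ = to-strictMono (inverse φ) (N (to x)) (N (to y))
                      (strictlyDecreasing (to x) (to y) (to-strictMono φ y x y<x))
        in (λ i → ≤-trans (≈⇒≤ (conj x i)) (≤-trans (p i) (≈⇒≤ (≈-sym (conj y i))))) ,
           (λ Mx≈My → ≉ λ i → ≈-trans (≈-sym (conj x i)) (≈-trans (Mx≈My i) (conj y i)))
    }
    where open IsStrictFuzzyNegation strict

  isStrongFuzzyNegation⁺ : IsStrongFuzzyNegation 𝒩 → IsStrongFuzzyNegation ℳ
  isStrongFuzzyNegation⁺ strong = record
    { isFuzzyNegation = isFuzzyNegation⁺ isFuzzyNegation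
    -- Between the two applications of `N`, `to` cancels `from`, leaving `from (N (N (to x)))`.
    ; involutive = λ x i → ≈-trans (conj (M x) i)
        (≈-trans (from-cong (N (to (M x))) (to x) (λ j → ≈-trans
            (N-cong {to (M x)} {N (to x)} (λ k → ≈-trans
              (to-cong (M x) (from (N (to x))) (conj x) k) (to∘from (N (to x)) k)) j)
            (involutive (to x) j)) i)
          (from∘to x i))
    }
    where
    open IsStrongFuzzyNegation strong
    open OrderIso (inverse φ) using () renaming (to-cong to from-cong)

proposition33 : ExcludedMiddle 0ℓ →
    ∀ (n : ℕ) → n ≥ 1 → (φ : Automorphism n) (𝒩 : Endo n) →
    (IsFuzzyNegation 𝒩 ⇔ IsFuzzyNegation (𝒩 ^ φ)) ×
    (IsStrictFuzzyNegation 𝒩 ⇔ IsStrictFuzzyNegation (𝒩 ^ φ)) ×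
    (IsStrongFuzzyNegation 𝒩 ⇔ IsStrongFuzzyNegation (𝒩 ^ φ))
proposition33 em n _ φ 𝒩 =
  mk⇔ Forth.isFuzzyNegation⁺ Back.isFuzzyNegation⁺ ,
  mk⇔ (Forth.isStrictFuzzyNegation⁺ em) (Back.isStrictFuzzyNegation⁺ em) ,
  mk⇔ Forth.isStrongFuzzyNegation⁺ Back.isStrongFuzzyNegation⁺
  where
  open OrderIso (orderIso φ)
  open Func 𝒩 using () renaming (to to N; cong to N-cong)
  module Forth = Conjugate (orderIso φ) 𝒩 (𝒩 ^ φ) (λ x i → ≈-refl)
  -- Conjugating `𝒩 ^ φ` by the inverse returns `𝒩` after cancelling `to` with `from` on both sides
  -- of `N`.
  module Back  = Conjugate (inverse (orderIso φ)) (𝒩 ^ φ) 𝒩 (λ x i → ≈-sym (≈-trans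
    (to∘from (N (to (from x))) i) (N-cong {to (from x)} {x} (to∘from x) i)))
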